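{- Let $L$ be a sublattice of $A_n$ of rank $n$. Then $$\Sigma^c(L)=\bigcup_{\nu\in\mathrm{Ext}^c(L)}\{x\in\mathbb R^{n+1}:x\ge\nu\}.$$
   Context: Let $n\ge 1$, $H_0=\{x\in\mathbb R^{n+1}:\sum_i x_i=0\}$ and $A_n=H_0\cap\mathbb Z^{n+1}$. For $x\in\mathbb R^{n+1}$, $\deg(x)=\sum_i x_i$. Write $x\le y$ iff $x_i\le y_i$ for all $i$. Let $\Sigma^{\mathbb R}(L)=\{x\in\mathbb R^{n+1}: x\not\le q\text{ for all }q\in L\}$ and let $\Sigma^c(L)$ be its topological closure in $\mathbb R^{n+1}$. $\mathrm{Ext}^c(L)$ is the set of points $x\in\Sigma^c(L)$ that are local minima of $\deg$ on $\Sigma^c(L)$, i.e. there is an open ball $B\ni x$ with $\deg(x)\le\deg(y)$ for all $y\in B\cap\Sigma^c(L)$. -}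

module Defs where

open import Level using (0ℓ)
open import Data.Nat.Base as ℕ using (ℕ; suc)
import Data.Nat.Properties as ℕ
open import Data.Integer.Base as ℤ using (ℤ; 0ℤ)
open import Data.Rational.Base as ℚ using (ℚ; 0ℚ; 1ℚ; ½; ∣_∣)
import Data.Rational.Properties as ℚ
open import Data.Rational.Solver using (module +-*-Solver)
open import Data.Vec.Functional using (Vector; foldr)
open import Data.Product.Base using (∃; _×_; _,_)
open import Relation.Binary.PropositionalEquality
  using (_≡_; _≗_; refl; sym; trans; cong; cong₂; subst)
open import Relation.Binary.Definitions using (_Respects_)
open import Relation.Nullary.Negation.Core using (¬_)
open import Relation.Unary using (Pred; _∈_; _⊆_; _∩_; _≬_)

------------------------------------------------------------------------
-- Real numbers: Cauchy sequences of rationals, taken up to the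
-- equivalence _≈_.

IsCauchy : (ℕ → ℚ) → Set
IsCauchy s = ∀ ε → 0ℚ ℚ.< ε →
  ∃ λ N → ∀ m n → N ℕ.≤ m → N ℕ.≤ n → ∣ s m ℚ.- s n ∣ ℚ.< ε

record ℝ : Set where
  constructor mkℝ
  field
    seq    : ℕ → ℚ
    cauchy : IsCauchy seq

open ℝ public

infix 4 _≈_ _≤_ _<_

_≈_ : ℝ → ℝ → Set
x ≈ y = ∀ ε → 0ℚ ℚ.< ε →
  ∃ λ N → ∀ n → N ℕ.≤ n → ∣ seq x n ℚ.- seq y n ∣ ℚ.< ε

_≤_ : ℝ → ℝ → Set
x ≤ y = ∀ ε → 0ℚ ℚ.< ε →
  ∃ λ N → ∀ n → N ℕ.≤ n → seq x n ℚ.< seq y n ℚ.+ ε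

_<_ : ℝ → ℝ → Set
x < y = ∃ λ ε → 0ℚ ℚ.< ε ×
  ∃ λ N → ∀ n → N ℕ.≤ n → seq x n ℚ.+ ε ℚ.≤ seq y n

private
  half-pos : ∀ {ε} → 0ℚ ℚ.< ε → 0ℚ ℚ.< ½ ℚ.* ε
  half-pos {ε} p = subst (ℚ._< ½ ℚ.* ε) (ℚ.*-zeroʳ ½) (ℚ.*-monoʳ-<-pos ½ p)

  half+half : ∀ ε → ½ ℚ.* ε ℚ.+ ½ ℚ.* ε ≡ ε
  half+half ε = trans (sym (ℚ.*-distribʳ-+ ε ½ ½)) (ℚ.*-identityˡ ε)

  const-cauchy : ∀ p → IsCauchy (λ _ → p)
  const-cauchy p ε ε>0 = 0 , λ _ _ _ _ →
    subst (ℚ._< ε) (sym (cong ∣_∣ (ℚ.+-inverseʳ p))) ε>0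

  +-cauchy : ∀ {s t} → IsCauchy s → IsCauchy t → IsCauchy (λ n → s n ℚ.+ t n)
  +-cauchy {s} {t} cs ct ε ε>0 =
    let M , hs = cs (½ ℚ.* ε) (half-pos ε>0)
        N , ht = ct (½ ℚ.* ε) (half-pos ε>0)
    in M ℕ.⊔ N , λ m n p q → begin-strict
      ∣ (s m ℚ.+ t m) ℚ.- (s n ℚ.+ t n) ∣
        ≡⟨ cong ∣_∣ (rearrange (s m) (t m) (s n) (t n)) ⟩
      ∣ (s m ℚ.- s n) ℚ.+ (t m ℚ.- t n) ∣
        ≤⟨ ℚ.∣p+q∣≤∣p∣+∣q∣ (s m ℚ.- s n) (t m ℚ.- t n) ⟩
      ∣ s m ℚ.- s n ∣ ℚ.+ ∣ t m ℚ.- t n ∣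
        <⟨ ℚ.+-mono-< (hs m n (ℕ.m⊔n≤o⇒m≤o M N p) (ℕ.m⊔n≤o⇒m≤o M N q))
                      (ht m n (ℕ.m⊔n≤o⇒n≤o M N p) (ℕ.m⊔n≤o⇒n≤o M N q)) ⟩
      ½ ℚ.* ε ℚ.+ ½ ℚ.* ε
        ≡⟨ half+half ε ⟩
      ε ∎
    where
    open ℚ.≤-Reasoning
    rearrange : ∀ a b c d →
      (a ℚ.+ b) ℚ.- (c ℚ.+ d) ≡ (a ℚ.- c) ℚ.+ (b ℚ.- d)
    rearrange = solve 4 (λ a b c d →
      (a :+ b) :- (c :+ d) := (a :- c) :+ (b :- d)) refl
      where open +-*-Solver

  neg-cauchy : ∀ {s} → IsCauchy s → IsCauchy (λ n → ℚ.- s n)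
  neg-cauchy {s} cs ε ε>0 =
    let N , hs = cs ε ε>0
    in N , λ m n p q → subst (ℚ._< ε)
      (trans (sym (ℚ.∣-p∣≡∣p∣ (s m ℚ.- s n)))
             (cong ∣_∣ (ℚ.neg-distrib-+ (s m) (ℚ.- s n))))
      (hs m n p q)

  eventually-bounded : ∀ {s} → IsCauchy s → ∃ λ B → 0ℚ ℚ.< B ×
    ∃ λ N → ∀ n → N ℕ.≤ n → ∣ s n ∣ ℚ.≤ B
  eventually-bounded {s} cs =
    let N , hs = cs 1ℚ (ℚ.positive⁻¹ 1ℚ)
    in 1ℚ ℚ.+ ∣ s N ∣
     , ℚ.+-mono-<-≤ (ℚ.positive⁻¹ 1ℚ) (ℚ.0≤∣p∣ (s N))
     , N , λ n p → begin
      ∣ s n ∣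
        ≡⟨ cong ∣_∣ (split (s n) (s N)) ⟩
      ∣ (s n ℚ.- s N) ℚ.+ s N ∣
        ≤⟨ ℚ.∣p+q∣≤∣p∣+∣q∣ (s n ℚ.- s N) (s N) ⟩
      ∣ s n ℚ.- s N ∣ ℚ.+ ∣ s N ∣
        ≤⟨ ℚ.+-monoˡ-≤ ∣ s N ∣ (ℚ.<⇒≤ (hs n N p ℕ.≤-refl)) ⟩
      1ℚ ℚ.+ ∣ s N ∣ ∎
    where
    open ℚ.≤-Reasoning
    split : ∀ a b → a ≡ (a ℚ.- b) ℚ.+ b
    split = solve 2 (λ a b → a := (a :- b) :+ b) refl
      where open +-*-Solver

  ∣ab-cd∣-bound : ∀ A B δ a b c d → 0ℚ ℚ.< A → 0ℚ ℚ.< B →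
    ∣ a ∣ ℚ.≤ A → ∣ d ∣ ℚ.≤ B → ∣ a ℚ.- c ∣ ℚ.< δ → ∣ b ℚ.- d ∣ ℚ.< δ →
    ∣ a ℚ.* b ℚ.- c ℚ.* d ∣ ℚ.< (A ℚ.+ B) ℚ.* δ
  ∣ab-cd∣-bound A B δ a b c d A>0 B>0 a≤A d≤B a-c<δ b-d<δ = begin-strict
    ∣ a ℚ.* b ℚ.- c ℚ.* d ∣
      ≡⟨ cong ∣_∣ (rearrange a b c d) ⟩
    ∣ a ℚ.* (b ℚ.- d) ℚ.+ d ℚ.* (a ℚ.- c) ∣
      ≤⟨ ℚ.∣p+q∣≤∣p∣+∣q∣ (a ℚ.* (b ℚ.- d)) (d ℚ.* (a ℚ.- c)) ⟩
    ∣ a ℚ.* (b ℚ.- d) ∣ ℚ.+ ∣ d ℚ.* (a ℚ.- c) ∣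
      ≡⟨ cong₂ ℚ._+_ (ℚ.∣p*q∣≡∣p∣*∣q∣ a (b ℚ.- d)) (ℚ.∣p*q∣≡∣p∣*∣q∣ d (a ℚ.- c)) ⟩
    ∣ a ∣ ℚ.* ∣ b ℚ.- d ∣ ℚ.+ ∣ d ∣ ℚ.* ∣ a ℚ.- c ∣
      <⟨ ℚ.+-mono-< (bound A a (b ℚ.- d) A>0 a≤A b-d<δ)
                    (bound B d (a ℚ.- c) B>0 d≤B a-c<δ) ⟩
    A ℚ.* δ ℚ.+ B ℚ.* δ
      ≡⟨ ℚ.*-distribʳ-+ δ A B ⟨
    (A ℚ.+ B) ℚ.* δ ∎
    where
    open ℚ.≤-Reasoning
    rearrange : ∀ a b c d →
      a ℚ.* b ℚ.- c ℚ.* d ≡ a ℚ.* (b ℚ.- d) ℚ.+ d ℚ.* (a ℚ.- c)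
    rearrange = solve 4 (λ a b c d →
      a :* b :- c :* d := a :* (b :- d) :+ d :* (a :- c)) refl
      where open +-*-Solver
    bound : ∀ D p q → 0ℚ ℚ.< D → ∣ p ∣ ℚ.≤ D → ∣ q ∣ ℚ.< δ →
      ∣ p ∣ ℚ.* ∣ q ∣ ℚ.< D ℚ.* δ
    bound D p q D>0 p≤D q<δ = ℚ.≤-<-trans
      (ℚ.*-monoʳ-≤-nonNeg ∣ q ∣ {{ℚ.∣-∣-nonNeg q}} p≤D)
      (ℚ.*-monoʳ-<-pos D {{ℚ.positive D>0}} q<δ)

  divide-pos : ∀ C ε → 0ℚ ℚ.< C → 0ℚ ℚ.< ε → ∃ λ δ → 0ℚ ℚ.< δ × C ℚ.* δ ≡ ε
  divide-pos C ε C>0 ε>0 =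
      ε ℚ.* C⁻¹
    , subst (ℚ._< ε ℚ.* C⁻¹) (ℚ.*-zeroˡ C⁻¹)
        (ℚ.*-monoˡ-<-pos C⁻¹ {{ℚ.1/pos⇒pos C {{C-pos}}}} ε>0)
    , trans (ℚ.*-comm C (ε ℚ.* C⁻¹)) (trans (ℚ.*-assoc ε C⁻¹ C)
        (trans (cong (ε ℚ.*_) (ℚ.*-inverseˡ C {{C≢0}})) (ℚ.*-identityʳ ε)))
    where
    C-pos = ℚ.positive C>0
    C≢0   = ℚ.pos⇒nonZero C {{C-pos}}
    C⁻¹   = ℚ.1/_ C {{C≢0}}

  *-cauchy : ∀ {s t} → IsCauchy s → IsCauchy t → IsCauchy (λ n → s n ℚ.* t n)
  *-cauchy {s} {t} cs ct ε ε>0 =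
    let A , A>0 , K , hA = eventually-bounded {s} cs
        B , B>0 , L , hB = eventually-bounded {t} ct
        δ , δ>0 , eq = divide-pos (A ℚ.+ B) ε (ℚ.+-mono-< A>0 B>0) ε>0
        M , hs = cs δ δ>0
        N , ht = ct δ δ>0
    in (K ℕ.⊔ L) ℕ.⊔ (M ℕ.⊔ N) , λ m n p q →
      let p₁ = ℕ.m⊔n≤o⇒m≤o (K ℕ.⊔ L) (M ℕ.⊔ N) p
          p₂ = ℕ.m⊔n≤o⇒n≤o (K ℕ.⊔ L) (M ℕ.⊔ N) p
          q₁ = ℕ.m⊔n≤o⇒m≤o (K ℕ.⊔ L) (M ℕ.⊔ N) q
          q₂ = ℕ.m⊔n≤o⇒n≤o (K ℕ.⊔ L) (M ℕ.⊔ N) q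
      in subst (∣ s m ℚ.* t m ℚ.- s n ℚ.* t n ∣ ℚ.<_) eq
        (∣ab-cd∣-bound A B δ (s m) (t m) (s n) (t n) A>0 B>0
          (hA m (ℕ.m⊔n≤o⇒m≤o K L p₁))
          (hB n (ℕ.m⊔n≤o⇒n≤o K L q₁))
          (hs m n (ℕ.m⊔n≤o⇒m≤o M N p₂) (ℕ.m⊔n≤o⇒m≤o M N q₂))
          (ht m n (ℕ.m⊔n≤o⇒n≤o M N p₂) (ℕ.m⊔n≤o⇒n≤o M N q₂)))

infixl 6 _+_ _-_
infixl 7 _*_
infix  8 -_

fromℚ : ℚ → ℝ
fromℚ p = mkℝ (λ _ → p) (const-cauchy p)

fromℤ : ℤ → ℝ
fromℤ z = fromℚ (z ℚ./ 1)

0ℝ : ℝ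
0ℝ = fromℚ 0ℚ

_+_ : ℝ → ℝ → ℝ
x + y = mkℝ (λ n → seq x n ℚ.+ seq y n) (+-cauchy {seq x} {seq y} (cauchy x) (cauchy y))

-_ : ℝ → ℝ
- x = mkℝ (λ n → ℚ.- seq x n) (neg-cauchy {seq x} (cauchy x))

_-_ : ℝ → ℝ → ℝ
x - y = x + (- y)

_*_ : ℝ → ℝ → ℝ
x * y = mkℝ (λ n → seq x n ℚ.* seq y n) (*-cauchy {seq x} {seq y} (cauchy x) (cauchy y))

------------------------------------------------------------------------
-- ℝᵈ with its Euclidean topology

∑ : ∀ {d} → Vector ℝ d → ℝ
∑ = foldr _+_ 0ℝ

deg : ∀ {d} → Vector ℝ d → ℝ
deg = ∑

infix 4 _≤ᵛ_ _≥ᵛ_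

_≤ᵛ_ : ∀ {d} → Vector ℝ d → Vector ℝ d → Set
x ≤ᵛ y = ∀ i → x i ≤ y i

_≥ᵛ_ : ∀ {d} → Vector ℝ d → Vector ℝ d → Set
x ≥ᵛ y = y ≤ᵛ x

-- Open Euclidean ball; both sides of "distance < r" are squared, so
-- 0 < r has to be required separately.
Ball : ∀ {d} → Vector ℝ d → ℝ → Pred (Vector ℝ d) 0ℓ
Ball c r y = 0ℝ < r × ∑ (λ i → (y i - c i) * (y i - c i)) < r * r

Closure : ∀ {d} → Pred (Vector ℝ d) 0ℓ → Pred (Vector ℝ d) 0ℓ
Closure S x = ∀ r → 0ℝ < r → Ball x r ≬ S

-- The ball need not be centred at x.
LocalMin : ∀ {d} → (Vector ℝ d → ℝ) → Pred (Vector ℝ d) 0ℓ → Pred (Vector ℝ d) 0ℓ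
LocalMin f S x = x ∈ S ×
  ∃ λ c → ∃ λ r → x ∈ Ball c r × (∀ y → y ∈ Ball c r ∩ S → f x ≤ f y)

------------------------------------------------------------------------
-- Sublattices of Aₙ

ι : ∀ {d} → Vector ℤ d → Vector ℝ d
ι q i = fromℤ (q i)

H₀ : ∀ n → Pred (Vector ℝ (suc n)) 0ℓ
H₀ n x = deg x ≈ 0ℝ

A : ∀ n → Pred (Vector ℤ (suc n)) 0ℓ
A n q = ι q ∈ H₀ n

-- resp: integer vectors are functions on Fin, so a set of them has to be
-- closed under pointwise equality.
record IsSublattice {d} (L M : Pred (Vector ℤ d) 0ℓ) : Set where
  field
    resp     : L Respects _≗_
    sub      : L ⊆ M
    0-closed : (λ _ → 0ℤ) ∈ L
    +-closed : ∀ {p q} → p ∈ L → q ∈ L → (λ i → p i ℤ.+ q i) ∈ L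
    neg-closed : ∀ {p} → p ∈ L → (λ i → ℤ.- p i) ∈ L

lincomb : ∀ {d r} → Vector ℤ r → Vector (Vector ℤ d) r → Vector ℤ d
lincomb c b i = foldr ℤ._+_ 0ℤ (λ k → c k ℤ.* b k i)

LinearlyIndependent : ∀ {d r} → Vector (Vector ℤ d) r → Set
LinearlyIndependent b = ∀ c → lincomb c b ≗ (λ _ → 0ℤ) → c ≗ (λ _ → 0ℤ)

record IsBasis {d r} (L : Pred (Vector ℤ d) 0ℓ) (b : Vector (Vector ℤ d) r) : Set where
  field
    members     : ∀ k → b k ∈ L
    independent : LinearlyIndependent b
    spanning    : ∀ {q} → q ∈ L → ∃ λ c → q ≗ lincomb c b

HasRank : ∀ {d} → Pred (Vector ℤ d) 0ℓ → ℕ → Set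
HasRank {d} L r = ∃ λ (b : Vector (Vector ℤ d) r) → IsBasis L b

------------------------------------------------------------------------

Σᴿ : ∀ {d} → Pred (Vector ℤ d) 0ℓ → Pred (Vector ℝ d) 0ℓ
Σᴿ L x = ∀ q → q ∈ L → ¬ (x ≤ᵛ ι q)

Σᶜ : ∀ {d} → Pred (Vector ℤ d) 0ℓ → Pred (Vector ℝ d) 0ℓ
Σᶜ L = Closure (Σᴿ L)

Extᶜ : ∀ {d} → Pred (Vector ℤ d) 0ℓ → Pred (Vector ℝ d) 0ℓ
Extᶜ L = LocalMin deg (Σᶜ L)

{-# OPTIONS --safe #-}

-- A point x lies in Σᶜ L iff every q ∈ L has a coordinate with q i ≤ x i.
-- As q is integral, this depends only on the floors of the coordinates of x,
-- so it suffices to look below integral points of Σᶜ L.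
-- Full rank provides, for each i, a vector of L positive off i; its large
-- multiples bound from below the i-th coordinate of the integral points of
-- Σᶜ L below a given one, so descent by unit steps ends at some ν.  Each
-- refused step in direction i is witnessed by q ∈ L with ν i ≤ q i and
-- ν j < q j for j ≠ i.  A point y of Σᶜ L near ν can satisfy q j ≤ y j only
-- for j = i, so ν ≤ y: hence ν is a local minimum of deg.

module Submission where

open import Defs
open import Level using (0ℓ)
open import Axiom.ExcludedMiddle using (ExcludedMiddle)
open import Data.Fin.Base using (Fin; zero; suc; punchIn; punchOut)
import Data.Fin.Properties as Fin
open import Data.Nat.Base as ℕ using (ℕ; zero; suc)
import Data.Nat.Coprimality as Coprimality
import Data.Nat.Properties as ℕ
open import Data.Integer.Base as ℤ using (ℤ; 0ℤ; 1ℤ; +_; -[1+_])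
import Data.Integer.Properties as ℤ
open import Data.Integer.Tactic.RingSolver using (solve-∀)
open import Data.Rational.Base as ℚ using (ℚ; mkℚ; 0ℚ; 1ℚ; ½; ∣_∣; *≤*)
import Data.Rational.Properties as ℚ
open import Data.Rational.Solver using (module +-*-Solver)
open import Data.Product.Base using (∃; _×_; _,_; proj₁; proj₂)
open import Data.Sum.Base using (inj₁; inj₂; [_,_])
open import Data.Vec.Functional using (Vector; insertAt; removeAt; updateAt)
open import Data.Vec.Functional.Properties
  using (insertAt-lookup; insertAt-punchIn; updateAt-updates; updateAt-minimal)
open import Function.Base using (_∘_)
open import Relation.Binary.PropositionalEquality
  using (_≡_; _≢_; _≗_; refl; sym; trans; cong; cong₂; subst; module ≡-Reasoning)
open import Relation.Nullary using (¬_; Dec; yes; no; ¬?; contradiction; decidable-stable)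
open import Relation.Unary using (Pred; _∈_; _≐_; ⋃)

import Algebra.Properties.Semiring.Sum as SemiringSum
open SemiringSum ℤ.+-*-semiring
  using (sum; sum-cong-≗; sum-replicate-zero; sum-remove; ∑-distrib-+; *-distribʳ-sum)

-- Integral linear algebra and descent

-- If f vanishes, a = 1 serves as a fake pivot, which spares a case distinction
-- in the elimination step.
pivot : ∀ {n} (f : Vector ℤ (suc n)) →
  ∃ λ k → ∃ λ a → a ≢ 0ℤ × (∀ j → f j ℤ.* a ≡ f j ℤ.* f k)
pivot f with Fin.any? (λ k → ¬? (f k ℤ.≟ 0ℤ))
... | yes (k , fk≢0) = k , f k , fk≢0 , λ _ → refl
... | no  ¬∃ = zero , 1ℤ , (λ ()) , λ j →
  let fj≡0 = decidable-stable (f j ℤ.≟ 0ℤ) (λ fj≢0 → ¬∃ (j , fj≢0))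
  in trans (cong (ℤ._* 1ℤ) fj≡0) (sym (cong (ℤ._* f zero) fj≡0))

-- Lifts a relation among eliminated vectors to one among `w`: the multiples of `w k` subtracted
-- along the way collect into the single coefficient inserted at `k`.
lincomb-insertAt : ∀ {n d} (c : Vector ℤ n) (w : Vector (Vector ℤ d) (suc n)) k a (e : Vector ℤ n) i →
  lincomb (insertAt (λ j → c j ℤ.* a) k (sum (λ j → ℤ.- (c j ℤ.* e j)))) w i ≡
  lincomb c (λ j i → w (punchIn k j) i ℤ.* a ℤ.- e j ℤ.* w k i) i
lincomb-insertAt c w k a e i = begin
  lincomb c′ w i
    ≡⟨ sum-remove {i = k} (λ j → c′ j ℤ.* w j i) ⟩
  c′ k ℤ.* w k i ℤ.+ sum (λ j → c′ (punchIn k j) ℤ.* w (punchIn k j) i)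
    ≡⟨ cong₂ ℤ._+_ (cong (ℤ._* w k i) (insertAt-lookup ca k c₀))
         (sum-cong-≗ (λ j → cong (ℤ._* w (punchIn k j) i) (insertAt-punchIn ca k c₀ j))) ⟩
  c₀ ℤ.* w k i ℤ.+ sum caw
    ≡⟨ cong (ℤ._+ sum caw) (*-distribʳ-sum (w k i) -ce) ⟩
  sum (λ j → -ce j ℤ.* w k i) ℤ.+ sum caw
    ≡⟨ ∑-distrib-+ (λ j → -ce j ℤ.* w k i) caw ⟨
  sum (λ j → -ce j ℤ.* w k i ℤ.+ caw j)
    ≡⟨ sum-cong-≗ (λ j → factor (c j) (e j) (w k i) a (w (punchIn k j) i)) ⟩
  lincomb c (λ j i → w (punchIn k j) i ℤ.* a ℤ.- e j ℤ.* w k i) i ∎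
  where
  open ≡-Reasoning
  ca  = λ j → c j ℤ.* a
  -ce = λ j → ℤ.- (c j ℤ.* e j)
  caw = λ j → c j ℤ.* a ℤ.* w (punchIn k j) i
  c₀  = sum -ce
  c′  = insertAt ca k c₀
  factor : ∀ c e x a y →
    ℤ.- (c ℤ.* e) ℤ.* x ℤ.+ c ℤ.* a ℤ.* y ≡ c ℤ.* (y ℤ.* a ℤ.- e ℤ.* x)
  factor = solve-∀

-- Fraction-free Gaussian elimination: clearing the first coordinate with a pivot leaves one vector
-- and one coordinate fewer. A relation among the remaining vectors lifts, and a nonzero coefficient
-- stays nonzero because it is multiplied by `a ≢ 0`.
linearlyDependent : ∀ {n} (w : Vector (Vector ℤ n) (suc n)) →
  ∃ λ c → (∃ λ k → c k ≢ 0ℤ) × lincomb c w ≗ (λ _ → 0ℤ)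
linearlyDependent {zero}  w = (λ _ → 1ℤ) , (zero , λ ()) , λ ()
linearlyDependent {suc n} w =
  let k , a , a≢0 , fa≡ffk = pivot f
      u : Vector (Vector ℤ (suc n)) (suc n)
      u j i = w (punchIn k j) i ℤ.* a ℤ.- f (punchIn k j) ℤ.* w k i
      c , (l , cl≢0) , cu≡0 = linearlyDependent (λ j i → u j (suc i))
      c₀ = sum (λ j → ℤ.- (c j ℤ.* f (punchIn k j)))
      c′ = insertAt (λ j → c j ℤ.* a) k c₀
      c′l≢0 : c′ (punchIn k l) ≢ 0ℤ
      c′l≢0 eq = [ cl≢0 , a≢0 ]
        (ℤ.i*j≡0⇒i≡0∨j≡0 (c l) (trans (sym (insertAt-punchIn _ k c₀ l)) eq))
      c′w≡cu = lincomb-insertAt c w k a (f ∘ punchIn k)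
      -- The induction hypothesis covers only the coordinates after the first; in the first one each
      -- `u j` vanishes by the choice of `a`.
      cu₀≡0 : lincomb c u zero ≡ 0ℤ
      cu₀≡0 = trans
        (sum-cong-≗ (λ j → trans (cong (c j ℤ.*_) (ℤ.i≡j⇒i-j≡0 (fa≡ffk (punchIn k j)))) (ℤ.*-zeroʳ (c j))))
        (sum-replicate-zero (suc n))
  in c′ , (punchIn k l , c′l≢0) , λ
    { zero    → trans (c′w≡cu zero) cu₀≡0
    ; (suc i) → trans (c′w≡cu (suc i)) (cu≡0 i) }
  where
  f : Vector ℤ (suc (suc n))
  f j = w j zero

-- Lattice vectors positive off one coordinate

module _ {d} {L M : Pred (Vector ℤ d) 0ℓ} (lattice : IsSublattice L M) where
  open IsSublattice lattice

  ℕ*-closed : ∀ n {p} → p ∈ L → (λ i → + n ℤ.* p i) ∈ L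
  ℕ*-closed zero    {p} p∈L = resp (λ i → sym (ℤ.*-zeroˡ (p i))) 0-closed
  ℕ*-closed (suc n) {p} p∈L = resp (λ i → sym (ℤ.suc-* (+ n) (p i))) (+-closed p∈L (ℕ*-closed n p∈L))

  *-closed : ∀ z {p} → p ∈ L → (λ i → z ℤ.* p i) ∈ L
  *-closed (+ n)    p∈L = ℕ*-closed n p∈L
  *-closed -[1+ n ] {p} p∈L = resp (λ i → ℤ.neg-distribˡ-* (+ suc n) (p i))
    (neg-closed (ℕ*-closed (suc n) p∈L))

  lincomb-closed : ∀ {r} c (b : Vector (Vector ℤ d) r) → (∀ k → b k ∈ L) → lincomb c b ∈ L
  lincomb-closed {zero}  c b b∈L = 0-closed
  lincomb-closed {suc r} c b b∈L = +-closed (*-closed (c zero) (b∈L zero))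
    (lincomb-closed (c ∘ suc) (b ∘ suc) (b∈L ∘ suc))

≢⇒punchIn : ∀ {n} {i j : Fin (suc n)} → i ≢ j → ∃ λ k → j ≡ punchIn i k
≢⇒punchIn i≢j = punchOut i≢j , sym (Fin.punchIn-punchOut i≢j)

sum≡0∧zeroOff⇒zero : ∀ {n} (p : Vector ℤ (suc n)) i → sum p ≡ 0ℤ →
  (∀ j → p (punchIn i j) ≡ 0ℤ) → p ≗ (λ _ → 0ℤ)
sum≡0∧zeroOff⇒zero {n} p i sum≡0 off j with i Fin.≟ j
... | no i≢j = let k , j≡ = ≢⇒punchIn i≢j in trans (cong p j≡) (off k)
... | yes refl = begin
  p i                              ≡⟨ ℤ.+-identityʳ (p i) ⟨
  p i ℤ.+ 0ℤ                       ≡⟨ cong (ℤ._+_ (p i)) (trans (sum-cong-≗ off) (sum-replicate-zero n)) ⟨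
  p i ℤ.+ sum (removeAt p i)       ≡⟨ sum-remove {i = i} p ⟨
  sum p                            ≡⟨ sum≡0 ⟩
  0ℤ                               ∎
  where open ≡-Reasoning

module _ {n} {L M : Pred (Vector ℤ (suc n)) 0ℓ} (lattice : IsSublattice L M)
  (sum≡0 : ∀ {q} → q ∈ L → sum q ≡ 0ℤ) (rank : HasRank L n) where
  open IsSublattice lattice
  open IsBasis (proj₂ rank)

  private
    b = proj₁ rank

  -- The `n` basis vectors with coordinate `i` deleted, together with the all-ones vector, are
  -- `n + 1` vectors in `n` coordinates. A relation among them yields a lattice vector that is
  -- constant off `i`; once that constant is nonzero, a sign change makes it positive.
  positiveOff : ∀ i → ∃ λ p → p ∈ L × (∀ j → 0ℤ ℤ.< p (punchIn i j))
  positiveOff i = bySign (c zero) refl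
    where
    w : Vector (Vector ℤ n) (suc n)
    w zero    j = 1ℤ
    w (suc k) j = b k (punchIn i j)
    dependency = linearlyDependent w
    c = proj₁ dependency
    p = lincomb (c ∘ suc) b
    p∈L : p ∈ L
    p∈L = lincomb-closed lattice (c ∘ suc) b members
    c₀+p≡0 : ∀ j → c zero ℤ.+ p (punchIn i j) ≡ 0ℤ
    c₀+p≡0 j = trans (cong (ℤ._+ p (punchIn i j)) (sym (ℤ.*-identityʳ (c zero)))) (proj₂ (proj₂ dependency) j)
    p≡-c₀ : ∀ j → p (punchIn i j) ≡ ℤ.- c zero
    p≡-c₀ j = trans (cancel (c zero) (p (punchIn i j)))
      (trans (cong (ℤ._+ ℤ.- c zero) (c₀+p≡0 j)) (ℤ.+-identityˡ _))
      where
      cancel : ∀ x y → y ≡ (x ℤ.+ y) ℤ.+ ℤ.- x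
      cancel = solve-∀
    -- Otherwise `p` vanishes off `i`, hence everywhere since its entries sum to zero, and
    -- independence of the basis kills every coefficient of the relation.
    c₀≢0 : c zero ≢ 0ℤ
    c₀≢0 c₀≡0 = let k , ck≢0 = proj₁ (proj₂ dependency) in ck≢0 (c≡0 k)
      where
      p≡0 : p ≗ (λ _ → 0ℤ)
      p≡0 = sum≡0∧zeroOff⇒zero p i (sum≡0 p∈L) (λ j → trans (p≡-c₀ j) (cong ℤ.-_ c₀≡0))
      c≡0 : ∀ k → c k ≡ 0ℤ
      c≡0 zero    = c₀≡0
      c≡0 (suc k) = independent (c ∘ suc) p≡0 k
    bySign : ∀ z → c zero ≡ z → ∃ λ p → p ∈ L × (∀ j → 0ℤ ℤ.< p (punchIn i j))
    bySign (+ zero)  c₀≡z = contradiction c₀≡z c₀≢0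
    bySign (+ suc m) c₀≡z = (λ j → ℤ.- p j) , neg-closed p∈L , λ j →
      subst (0ℤ ℤ.<_) (sym (trans (cong ℤ.-_ (p≡-c₀ j)) (trans (ℤ.neg-involutive _) c₀≡z))) (ℤ.+<+ ℕ.z<s)
    bySign -[1+ m ]  c₀≡z = p , p∈L , λ j →
      subst (0ℤ ℤ.<_) (sym (trans (p≡-c₀ j) (cong ℤ.-_ c₀≡z))) (ℤ.+<+ ℕ.z<s)

-- Descent to minimal integral points

∑-mono-≤ : ∀ {n} (p q : Vector ℤ n) → (∀ i → p i ℤ.≤ q i) → sum p ℤ.≤ sum q
∑-mono-≤ {zero}  p q p≤q = ℤ.≤-refl
∑-mono-≤ {suc n} p q p≤q = ℤ.+-mono-≤ (p≤q zero) (∑-mono-≤ (p ∘ suc) (q ∘ suc) (p≤q ∘ suc))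

sum-updateAt-pred : ∀ {n} (p : Vector ℤ n) i → sum (updateAt p i ℤ.pred) ≡ ℤ.pred (sum p)
sum-updateAt-pred p zero    = ℤ.pred-+ (p zero) (sum (p ∘ suc))
sum-updateAt-pred p (suc i) = trans (cong (ℤ._+_ (p zero)) (sum-updateAt-pred (p ∘ suc) i)) (ℤ.+-pred (p zero) (sum (p ∘ suc)))

updateAt-pred-≤ : ∀ {n} (p : Vector ℤ n) i j → updateAt p i ℤ.pred j ℤ.≤ p j
updateAt-pred-≤ p i j with i Fin.≟ j
... | yes refl = ℤ.≤-trans (ℤ.≤-reflexive (updateAt-updates i p)) (ℤ.i≤j⇒pred[i]≤j ℤ.≤-refl)
... | no i≢j   = ℤ.≤-reflexive (updateAt-minimal j i p (i≢j ∘ sym))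

i≤∣i∣ : ∀ i → i ℤ.≤ + ℤ.∣ i ∣
i≤∣i∣ (+ m)    = ℤ.≤-refl
i≤∣i∣ -[1+ m ] = ℤ.-≤+

strictUpperBound : ∀ {n} (p : Vector ℤ n) → ∃ λ (K : ℕ) → ∀ i → p i ℤ.< + K
strictUpperBound {zero}  p = 0 , λ ()
strictUpperBound {suc n} p =
  let K , p<K = strictUpperBound (p ∘ suc)
      k = ℤ.∣ p zero ∣
  in suc k ℕ.⊔ K , λ
    { zero    → ℤ.≤-<-trans (i≤∣i∣ (p zero)) (ℤ.+<+ (ℕ.m≤m⊔n (suc k) K))
    ; (suc i) → ℤ.<-≤-trans (p<K i) (ℤ.+≤+ (ℕ.m≤n⊔m (suc k) K)) }

-- The integral points of Σᶜ L, see Σᶜ⇒reaches and reaches⇒Σᶜ.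
Σᶻ : ∀ {d} → Pred (Vector ℤ d) 0ℓ → Pred (Vector ℤ d) 0ℓ
Σᶻ L z = ∀ q → q ∈ L → ∃ λ i → q i ℤ.≤ z i

module _ {d} {L M : Pred (Vector ℤ (suc d)) 0ℓ} (lattice : IsSublattice L M)
  (positive : ∀ i → ∃ λ p → p ∈ L × (∀ j → 0ℤ ℤ.< p (punchIn i j))) where

  -- Let `p` in `L` be positive off `i`, and let `K` exceed every entry of `z`. Then `K p` exceeds
  -- `z`, hence `y`, at each coordinate other than `i`, so `y` can reach `K p` only at `i`.
  Σᶻ-boundedBelow : ∀ z → ∃ λ ℓ → ∀ y → y ∈ Σᶻ L → (∀ i → y i ℤ.≤ z i) → ∀ i → ℓ i ℤ.≤ y i
  Σᶻ-boundedBelow z = (λ i → + K ℤ.* proj₁ (positive i) i) , bound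
    where
    K = proj₁ (strictUpperBound z)
    bound : ∀ y → y ∈ Σᶻ L → (∀ i → y i ℤ.≤ z i) → ∀ i → + K ℤ.* proj₁ (positive i) i ℤ.≤ y i
    bound y y∈Σ y≤z i with positive i
    ... | p , p∈L , p>0 with y∈Σ (λ j → + K ℤ.* p j) (*-closed lattice (+ K) p∈L)
    ...   | j , Kp≤y with i Fin.≟ j
    ...     | yes refl = Kp≤y
    ...     | no i≢j = contradiction z<z (ℤ.<-irrefl refl)
      where
      open ℤ.≤-Reasoning
      1≤pj : 1ℤ ℤ.≤ p j
      1≤pj = let k , j≡ = ≢⇒punchIn i≢j in subst (λ j → 1ℤ ℤ.≤ p j) (sym j≡) (ℤ.i<j⇒suc[i]≤j (p>0 k))
      z<z : z j ℤ.< z j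
      z<z = begin-strict
        z j           <⟨ proj₂ (strictUpperBound z) j ⟩
        + K           ≡⟨ ℤ.*-identityʳ (+ K) ⟨
        + K ℤ.* 1ℤ    ≤⟨ ℤ.*-monoˡ-≤-nonNeg (+ K) 1≤pj ⟩
        + K ℤ.* p j   ≤⟨ Kp≤y ⟩
        y j           ≤⟨ y≤z j ⟩
        z j           ∎

  private
    MinimalBelow : Vector ℤ (suc d) → Set
    MinimalBelow z = ∃ λ ν → ν ∈ Σᶻ L × (∀ i → ν i ℤ.≤ z i) × (∀ i → ¬ Σᶻ L (updateAt ν i ℤ.pred))

  Σᶻ-minimal : ExcludedMiddle 0ℓ → ∀ z → z ∈ Σᶻ L → MinimalBelow z
  Σᶻ-minimal em z z∈Σ = descend ℤ.∣ sum z ℤ.- sum ℓ ∣ z z∈Σ (λ _ → ℤ.≤-refl)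
    (ℤ.≤-trans (ℤ.≤-reflexive (split (sum z) (sum ℓ))) (ℤ.+-monoʳ-≤ (sum ℓ) (i≤∣i∣ _)))
    where
    ℓ = proj₁ (Σᶻ-boundedBelow z)
    split : ∀ a b → a ≡ b ℤ.+ (a ℤ.- b)
    split = solve-∀
    -- `k` is the fuel: it bounds the excess of `sum y` over `sum ℓ`, and a unit step lowers both by
    -- one.
    descend : ∀ k y → y ∈ Σᶻ L → (∀ i → y i ℤ.≤ z i) → sum y ℤ.≤ sum ℓ ℤ.+ + k →
      MinimalBelow z
    descend k y y∈Σ y≤z sum≤ with em {∃ λ i → Σᶻ L (updateAt y i ℤ.pred)}
    ... | no ∄ = y , y∈Σ , y≤z , λ i y′∈Σ → ∄ (i , y′∈Σ)
    ... | yes (i , y′∈Σ) = step k sum≤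
      where
      open ℤ.≤-Reasoning
      y′ = updateAt y i ℤ.pred
      y′≤z : ∀ j → y′ j ℤ.≤ z j
      y′≤z j = ℤ.≤-trans (updateAt-pred-≤ y i j) (y≤z j)
      step : ∀ k → sum y ℤ.≤ sum ℓ ℤ.+ + k → MinimalBelow z
      -- With no fuel left, one more step would bring the sum below that of the lower bound `ℓ`.
      step zero sum≤ = contradiction (begin-strict
        sum ℓ          ≤⟨ ∑-mono-≤ ℓ y′ (proj₂ (Σᶻ-boundedBelow z) y′ y′∈Σ y′≤z) ⟩
        sum y′         ≡⟨ sum-updateAt-pred y i ⟩
        ℤ.pred (sum y) <⟨ ℤ.i≤pred[j]⇒i<j ℤ.≤-refl ⟩
        sum y          ≤⟨ sum≤ ⟩
        sum ℓ ℤ.+ 0ℤ   ≡⟨ ℤ.+-identityʳ (sum ℓ) ⟩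
        sum ℓ          ∎) (ℤ.<-irrefl refl)
      step (suc k) sum≤ = descend k y′ y′∈Σ y′≤z (begin
        sum y′                       ≡⟨ sum-updateAt-pred y i ⟩
        ℤ.pred (sum y)               ≤⟨ ℤ.pred-mono sum≤ ⟩
        ℤ.pred (sum ℓ ℤ.+ + suc k)   ≡⟨ ℤ.+-pred (sum ℓ) (+ suc k) ⟨
        sum ℓ ℤ.+ + k                ∎)

module _ {d} {L : Pred (Vector ℤ d) 0ℓ} (em : ExcludedMiddle 0ℓ) where

  ∉Σᶻ⇒below : ∀ z → ¬ Σᶻ L z → ∃ λ q → q ∈ L × (∀ i → z i ℤ.< q i)
  ∉Σᶻ⇒below z z∉Σ with em {∃ λ q → q ∈ L × (∀ i → z i ℤ.< q i)}
  ... | yes ∃q = ∃q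
  ... | no  ∄q = contradiction z∈Σ z∉Σ
    where
    z∈Σ : Σᶻ L z
    z∈Σ q q∈L with Fin.any? (λ i → q i ℤ.≤? z i)
    ... | yes ∃i = ∃i
    ... | no  ∄i = contradiction (q , q∈L , λ i → ℤ.≰⇒> (λ q≤z → ∄i (i , q≤z))) ∄q

  -- Some `q` in `L` lies strictly above `ν` lowered by one at `i`. At `i` integrality turns this
  -- into `ν i ≤ q i`; elsewhere the entries of `ν` are unchanged and the inequality stays strict.
  minimal⇒blocked : ∀ ν → (∀ i → ¬ Σᶻ L (updateAt ν i ℤ.pred)) →
    ∀ i → ∃ λ q → q ∈ L × ν i ℤ.≤ q i × (∀ j → i ≢ j → ν j ℤ.< q j)
  minimal⇒blocked ν min i =
    let q , q∈L , <q = ∉Σᶻ⇒below _ (min i)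
    in q , q∈L
     , subst (ℤ._≤ q i) (trans (cong ℤ.suc (updateAt-updates i ν)) (ℤ.suc-pred (ν i))) (ℤ.i<j⇒suc[i]≤j (<q i))
     , λ j i≢j → subst (ℤ._< q j) (updateAt-minimal j i ν (i≢j ∘ sym)) (<q j)

-- Rationals and Cauchy reals

p≡q+[p-q] : ∀ p q → p ≡ q ℚ.+ (p ℚ.- q)
p≡q+[p-q] = solve 2 (λ p q → p := q :+ (p :- q)) refl
  where open +-*-Solver

p≡p+q-q : ∀ p q → p ≡ p ℚ.+ q ℚ.- q
p≡p+q-q = solve 2 (λ p q → p := p :+ q :- q) refl
  where open +-*-Solver

half-pos : ∀ {ε} → 0ℚ ℚ.< ε → 0ℚ ℚ.< ½ ℚ.* ε
half-pos {ε} p = subst (ℚ._< ½ ℚ.* ε) (ℚ.*-zeroʳ ½) (ℚ.*-monoʳ-<-pos ½ p)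

half+half : ∀ ε → ½ ℚ.* ε ℚ.+ ½ ℚ.* ε ≡ ε
half+half ε = trans (sym (ℚ.*-distribʳ-+ ε ½ ½)) (ℚ.*-identityˡ ε)

p<p+ε : ∀ p {ε} → 0ℚ ℚ.< ε → p ℚ.< p ℚ.+ ε
p<p+ε p {ε} ε>0 = subst (ℚ._< p ℚ.+ ε) (ℚ.+-identityʳ p) (ℚ.+-monoʳ-< p ε>0)

half< : ∀ {ε} → 0ℚ ℚ.< ε → ½ ℚ.* ε ℚ.< ε
half< {ε} ε>0 = subst (½ ℚ.* ε ℚ.<_) (half+half ε) (p<p+ε (½ ℚ.* ε) (half-pos ε>0))

p≤∣p∣ : ∀ p → p ℚ.≤ ∣ p ∣
p≤∣p∣ p with ℚ.≤-total 0ℚ p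
... | inj₁ 0≤p = ℚ.≤-reflexive (sym (ℚ.0≤p⇒∣p∣≡p 0≤p))
... | inj₂ p≤0 = ℚ.≤-trans p≤0 (ℚ.0≤∣p∣ p)

∣p-q∣≡∣q-p∣ : ∀ p q → ∣ p ℚ.- q ∣ ≡ ∣ q ℚ.- p ∣
∣p-q∣≡∣q-p∣ p q = trans (cong ∣_∣ (swap p q)) (ℚ.∣-p∣≡∣p∣ (q ℚ.- p))
  where
  open +-*-Solver
  swap : ∀ p q → p ℚ.- q ≡ ℚ.- (q ℚ.- p)
  swap = solve 2 (λ p q → p :- q := :- (q :- p)) refl

∣p-q∣<ε⇒p<q+ε : ∀ p q {ε} → ∣ p ℚ.- q ∣ ℚ.< ε → p ℚ.< q ℚ.+ ε
∣p-q∣<ε⇒p<q+ε p q {ε} lt = begin-strict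
  p                      ≡⟨ p≡q+[p-q] p q ⟩
  q ℚ.+ (p ℚ.- q)        ≤⟨ ℚ.+-monoʳ-≤ q (p≤∣p∣ (p ℚ.- q)) ⟩
  q ℚ.+ ∣ p ℚ.- q ∣      <⟨ ℚ.+-monoʳ-< q lt ⟩
  q ℚ.+ ε                ∎
  where open ℚ.≤-Reasoning

0≤p² : ∀ p → 0ℚ ℚ.≤ p ℚ.* p
0≤p² p = subst (0ℚ ℚ.≤_) ∣pp∣≡pp (ℚ.0≤∣p∣ (p ℚ.* p))
  where
  ∣pp∣≡pp : ∣ p ℚ.* p ∣ ≡ p ℚ.* p
  ∣pp∣≡pp with ℚ.∣p∣≡p∨∣p∣≡-p p
  ... | inj₁ eq = trans (ℚ.∣p*q∣≡∣p∣*∣q∣ p p) (cong₂ ℚ._*_ eq eq)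
  ... | inj₂ eq = trans (ℚ.∣p*q∣≡∣p∣*∣q∣ p p) (trans (cong₂ ℚ._*_ eq eq) (neg² p))
    where
    open +-*-Solver
    neg² : ∀ p → (ℚ.- p) ℚ.* (ℚ.- p) ≡ p ℚ.* p
    neg² = solve 1 (λ p → (:- p) :* (:- p) := p :* p) refl

p²-mono-≤ : ∀ {p q} → 0ℚ ℚ.≤ p → p ℚ.≤ q → p ℚ.* p ℚ.≤ q ℚ.* q
p²-mono-≤ {p} {q} 0≤p p≤q = ℚ.≤-trans
  (ℚ.*-monoʳ-≤-nonNeg p {{ℚ.nonNegative 0≤p}} p≤q)
  (ℚ.*-monoˡ-≤-nonNeg q {{ℚ.nonNegative (ℚ.≤-trans 0≤p p≤q)}} p≤q)

p²-pos : ∀ {p} → 0ℚ ℚ.< p → 0ℚ ℚ.< p ℚ.* p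
p²-pos {p} p>0 = subst (ℚ._< p ℚ.* p) (ℚ.*-zeroʳ p) (ℚ.*-monoʳ-<-pos p {{ℚ.positive p>0}} p>0)

p²-cancel-< : ∀ {p q} → 0ℚ ℚ.≤ q → p ℚ.* p ℚ.< q ℚ.* q → p ℚ.< q
p²-cancel-< 0≤q p²<q² = ℚ.≰⇒> (λ q≤p → ℚ.<-irrefl refl (ℚ.<-≤-trans p²<q² (p²-mono-≤ 0≤q q≤p)))

-- For a variable `z` the normalisation in `z / 1` does not compute; rewriting with this exposes
-- numerator and denominator.
/1-def : ∀ z → z ℚ./ 1 ≡ mkℚ z 0 (Coprimality.sym (Coprimality.1-coprimeTo ℤ.∣ z ∣))
/1-def z = ℚ.↥p/↧p≡p (mkℚ z 0 (Coprimality.sym (Coprimality.1-coprimeTo ℤ.∣ z ∣)))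

/1-mono-≤ : ∀ {i j} → i ℤ.≤ j → i ℚ./ 1 ℚ.≤ j ℚ./ 1
/1-mono-≤ {i} {j} i≤j rewrite /1-def i | /1-def j = *≤* (ℤ.*-monoʳ-≤-nonNeg 1ℤ i≤j)

/1-cancel-< : ∀ {i j} → i ℚ./ 1 ℚ.< j ℚ./ 1 → i ℤ.< j
/1-cancel-< i<j = ℤ.≰⇒> (λ j≤i → ℚ.<-irrefl refl (ℚ.<-≤-trans i<j (/1-mono-≤ j≤i)))

/1-homo-+ : ∀ i j → (i ℤ.+ j) ℚ./ 1 ≡ i ℚ./ 1 ℚ.+ j ℚ./ 1
/1-homo-+ i j rewrite /1-def i | /1-def j =
  cong (ℚ._/ 1) (sym (cong₂ ℤ._+_ (ℤ.*-identityʳ i) (ℤ.*-identityʳ j)))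

-- The Archimedean property: a denominator is at least 1.
p≤∣↥p∣ : ∀ p → p ℚ.≤ + ℤ.∣ ℚ.↥ p ∣ ℚ./ 1
p≤∣↥p∣ (mkℚ (+ n) d _) rewrite /1-def (+ n) =
  *≤* (ℤ.*-monoˡ-≤-nonNeg (+ n) (ℤ.+≤+ (ℕ.s≤s (ℕ.z≤n {d}))))
p≤∣↥p∣ (mkℚ -[1+ n ] d _) rewrite /1-def (+ suc n) = *≤* ℤ.-≤+

-- Order on the Cauchy reals

≤-trans : ∀ {x y z} → x ≤ y → y ≤ z → x ≤ z
≤-trans {x} {y} {z} x≤y y≤z ε ε>0 =
  let h = ½ ℚ.* ε
      M , hx = x≤y h (half-pos ε>0)
      N , hy = y≤z h (half-pos ε>0)
  in M ℕ.⊔ N , λ n p → begin-strict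
    seq x n                 <⟨ hx n (ℕ.m⊔n≤o⇒m≤o M N p) ⟩
    seq y n ℚ.+ h           <⟨ ℚ.+-monoˡ-< h (hy n (ℕ.m⊔n≤o⇒n≤o M N p)) ⟩
    seq z n ℚ.+ h ℚ.+ h     ≡⟨ ℚ.+-assoc (seq z n) h h ⟩
    seq z n ℚ.+ (h ℚ.+ h)   ≡⟨ cong (seq z n ℚ.+_) (half+half ε) ⟩
    seq z n ℚ.+ ε           ∎
  where open ℚ.≤-Reasoning

+-mono-≤ : ∀ {x y u v} → x ≤ y → u ≤ v → x + u ≤ y + v
+-mono-≤ {x} {y} {u} {v} x≤y u≤v ε ε>0 =
  let h = ½ ℚ.* ε
      M , hx = x≤y h (half-pos ε>0)
      N , hu = u≤v h (half-pos ε>0)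
  in M ℕ.⊔ N , λ n p → begin-strict
    seq x n ℚ.+ seq u n
      <⟨ ℚ.+-mono-< (hx n (ℕ.m⊔n≤o⇒m≤o M N p)) (hu n (ℕ.m⊔n≤o⇒n≤o M N p)) ⟩
    (seq y n ℚ.+ h) ℚ.+ (seq v n ℚ.+ h)
      ≡⟨ regroup (seq y n) (seq v n) h ⟩
    (seq y n ℚ.+ seq v n) ℚ.+ (h ℚ.+ h)
      ≡⟨ cong (seq y n ℚ.+ seq v n ℚ.+_) (half+half ε) ⟩
    seq y n ℚ.+ seq v n ℚ.+ ε ∎
  where
  open ℚ.≤-Reasoning
  open +-*-Solver
  regroup : ∀ a b h → (a ℚ.+ h) ℚ.+ (b ℚ.+ h) ≡ (a ℚ.+ b) ℚ.+ (h ℚ.+ h)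
  regroup = solve 3 (λ a b h → (a :+ h) :+ (b :+ h) := (a :+ b) :+ (h :+ h)) refl

fromℤ-mono-≤ : ∀ {i j} → i ℤ.≤ j → fromℤ i ≤ fromℤ j
fromℤ-mono-≤ {j = j} i≤j ε ε>0 = 0 , λ _ _ → ℚ.≤-<-trans (/1-mono-≤ i≤j) (p<p+ε (j ℚ./ 1) ε>0)

deg-mono-≤ : ∀ {d} {x y : Vector ℝ d} → x ≤ᵛ y → deg x ≤ deg y
deg-mono-≤ {zero}          x≤y ε ε>0 = 0 , λ _ _ → p<p+ε 0ℚ ε>0
deg-mono-≤ {suc d} {x} {y} x≤y = +-mono-≤ {x zero} {y zero} {∑ (x ∘ suc)} {∑ (y ∘ suc)} (x≤y zero) (deg-mono-≤ (x≤y ∘ suc))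

-- Past `N` the difference `y - x` varies by less than `ε/4`, so one rational comparison with `ε/2`
-- at index `N` decides all later indices: either the difference stays below `ε`, or it stays at
-- least `ε/4`, which would give `x < y`.
≮⇒≥ : ∀ {x y} → ¬ (x < y) → y ≤ x
≮⇒≥ {x} {y} x≮y ε ε>0 =
  let κ>0 = half-pos (half-pos ε>0)
      N , close = cauchy (y - x) κ κ>0
  in N , λ n p → compare N close n p
  where
  open ℚ.≤-Reasoning
  θ = ½ ℚ.* ε
  κ = ½ ℚ.* θ
  δ = seq (y - x)
  compare : ∀ N → (∀ m n → N ℕ.≤ m → N ℕ.≤ n → ∣ δ m ℚ.- δ n ∣ ℚ.< κ) →
    ∀ n → N ℕ.≤ n → seq y n ℚ.< seq x n ℚ.+ ε
  compare N close n p with δ N ℚ.<? θ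
  ... | yes δN<θ = begin-strict
    seq y n                  ≡⟨ p≡q+[p-q] (seq y n) (seq x n) ⟩
    seq x n ℚ.+ δ n          <⟨ ℚ.+-monoʳ-< (seq x n) (begin-strict
      δ n           <⟨ ∣p-q∣<ε⇒p<q+ε (δ n) (δ N) (close n N p ℕ.≤-refl) ⟩
      δ N ℚ.+ κ     <⟨ ℚ.+-mono-< δN<θ (half< (half-pos ε>0)) ⟩
      θ ℚ.+ θ       ≡⟨ half+half ε ⟩
      ε             ∎) ⟩
    seq x n ℚ.+ ε            ∎
  ... | no δN≮θ = contradiction (κ , half-pos (half-pos ε>0) , N , λ m q → begin
    seq x m ℚ.+ κ                  ≤⟨ ℚ.+-monoʳ-≤ (seq x m) (κ≤δ m q) ⟩
    seq x m ℚ.+ δ m                ≡⟨ p≡q+[p-q] (seq y m) (seq x m) ⟨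
    seq y m                        ∎) x≮y
    where
    κ≤δ : ∀ m → N ℕ.≤ m → κ ℚ.≤ δ m
    κ≤δ m q = begin
      κ                     ≡⟨ p≡p+q-q κ κ ⟩
      κ ℚ.+ κ ℚ.- κ         ≡⟨ cong (ℚ._- κ) (half+half θ) ⟩
      θ ℚ.- κ               ≤⟨ ℚ.+-monoˡ-≤ (ℚ.- κ) (ℚ.≮⇒≥ δN≮θ) ⟩
      δ N ℚ.- κ             ≤⟨ ℚ.+-monoˡ-≤ (ℚ.- κ) (ℚ.<⇒≤ (∣p-q∣<ε⇒p<q+ε (δ N) (δ m) (close N m ℕ.≤-refl q))) ⟩
      δ m ℚ.+ κ ℚ.- κ       ≡⟨ p≡p+q-q (δ m) κ ⟨
      δ m                   ∎

seq-deg-ι : ∀ {d} (q : Vector ℤ d) n → seq (deg (ι q)) n ≡ sum q ℚ./ 1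
seq-deg-ι {zero}  q n = refl
seq-deg-ι {suc d} q n = trans (cong (q zero ℚ./ 1 ℚ.+_) (seq-deg-ι (q ∘ suc) n)) (sym (/1-homo-+ (q zero) (sum (q ∘ suc))))

-- Membership in `A n` says only that the real sum is equivalent to zero; an integer within distance
-- less than 1 of zero is zero.
A⇒sum≡0 : ∀ {n} {q : Vector ℤ (suc n)} → q ∈ A n → sum q ≡ 0ℤ
A⇒sum≡0 {n} {q} q∈A =
  let N , close = q∈A 1ℚ (ℚ.positive⁻¹ 1ℚ)
      z = sum q
      close′ = subst (λ s → ∣ s ℚ.- 0ℚ ∣ ℚ.< 1ℚ) (seq-deg-ι q N) (close N ℕ.≤-refl)
      z<1 : z ℤ.< 1ℤ
      z<1 = /1-cancel-< (∣p-q∣<ε⇒p<q+ε (z ℚ./ 1) 0ℚ close′)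
      0<z+1 : 0ℤ ℤ.< z ℤ.+ 1ℤ
      0<z+1 = /1-cancel-< (subst (0ℚ ℚ.<_) (sym (/1-homo-+ z 1ℤ))
        (∣p-q∣<ε⇒p<q+ε 0ℚ (z ℚ./ 1) (subst (ℚ._< 1ℚ) (∣p-q∣≡∣q-p∣ (z ℚ./ 1) 0ℚ) close′)))
  in ℤ.≤-antisym (ℤ.i<j⇒i≤pred[j] z<1)
       (subst (0ℤ ℤ.≤_) (trans (cong ℤ.pred (ℤ.+-comm z 1ℤ)) (ℤ.pred-suc z)) (ℤ.i<j⇒i≤pred[j] 0<z+1))

-- Floors of real numbers

greatest : ExcludedMiddle 0ℓ → (P : Pred ℤ 0ℓ) → ∀ a k → P a → (∀ q → P q → q ℤ.≤ a ℤ.+ + k) →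
  ∃ λ z → P z × (∀ q → P q → q ℤ.≤ z)
greatest em P a zero    Pa bound = a , Pa , λ q Pq → subst (q ℤ.≤_) (ℤ.+-identityʳ a) (bound q Pq)
greatest em P a (suc k) Pa bound with em {P (a ℤ.+ + suc k)}
... | yes Pu = a ℤ.+ + suc k , Pu , bound
... | no ¬Pu = greatest em P a k Pa λ q Pq →
  subst (q ℤ.≤_) (sym (ℤ.+-pred a (+ suc k)))
    (ℤ.i<j⇒i≤pred[j] (ℤ.≤∧≢⇒< (bound q Pq) (λ { refl → ¬Pu Pq })))

-- One term `s` of the sequence, accurate to within 1, gives crude integer bounds on `x`; excluded
-- middle then decides each candidate in a downward search between them.
floor : ExcludedMiddle 0ℓ → ∀ x → ∃ λ z → fromℤ z ≤ x × (∀ q → fromℤ q ≤ x → q ℤ.≤ z)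
floor em x =
  let N , close = cauchy x 1ℚ (ℚ.positive⁻¹ 1ℚ)
      s = seq x N
      -- One unit covers the error of `s`, the other the slack in `fromℤ q ≤ x`.
      B = ℤ.∣ ℚ.↥ (s ℚ.+ 1ℚ ℚ.+ 1ℚ) ∣
      C = ℤ.∣ ℚ.↥ (1ℚ ℚ.- s) ∣
      lower : fromℤ (ℤ.- + C) ≤ x
      lower ε ε>0 = N , λ n p → begin-strict
        ℤ.- + C ℚ./ 1         ≡⟨ p≡p+q-q (ℤ.- + C ℚ./ 1) (+ C ℚ./ 1) ⟩
        (ℤ.- + C ℚ./ 1 ℚ.+ + C ℚ./ 1) ℚ.- + C ℚ./ 1
          ≡⟨ cong (ℚ._- (+ C ℚ./ 1)) (trans (sym (/1-homo-+ (ℤ.- + C) (+ C))) (cong (ℚ._/ 1) (ℤ.+-inverseˡ (+ C)))) ⟩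
        0ℚ ℚ.- + C ℚ./ 1      ≤⟨ ℚ.+-monoʳ-≤ 0ℚ (ℚ.neg-antimono-≤ (p≤∣↥p∣ (1ℚ ℚ.- s))) ⟩
        0ℚ ℚ.- (1ℚ ℚ.- s)     ≡⟨ flip s 1ℚ ⟩
        s ℚ.- 1ℚ              ≤⟨ ℚ.+-monoˡ-≤ (ℚ.- 1ℚ) (ℚ.<⇒≤ (∣p-q∣<ε⇒p<q+ε s (seq x n) (close N n ℕ.≤-refl p))) ⟩
        seq x n ℚ.+ 1ℚ ℚ.- 1ℚ ≡⟨ p≡p+q-q (seq x n) 1ℚ ⟨
        seq x n               <⟨ p<p+ε (seq x n) ε>0 ⟩
        seq x n ℚ.+ ε         ∎
      -- The bound `B` is rewritten as a distance `C + B` above the starting point `- C` of the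
      -- search.
      upper : ∀ q → fromℤ q ≤ x → q ℤ.≤ ℤ.- + C ℤ.+ + (C ℕ.+ B)
      upper q q≤x =
        let M , q<x+1 = q≤x 1ℚ (ℚ.positive⁻¹ 1ℚ)
            n = M ℕ.⊔ N
        in ℤ.≤-trans (ℤ.<⇒≤ (/1-cancel-< (begin-strict
          q ℚ./ 1               <⟨ q<x+1 n (ℕ.m≤m⊔n M N) ⟩
          seq x n ℚ.+ 1ℚ        <⟨ ℚ.+-monoˡ-< 1ℚ (∣p-q∣<ε⇒p<q+ε (seq x n) s (close n N (ℕ.m≤n⊔m M N) ℕ.≤-refl)) ⟩
          s ℚ.+ 1ℚ ℚ.+ 1ℚ       ≤⟨ p≤∣↥p∣ (s ℚ.+ 1ℚ ℚ.+ 1ℚ) ⟩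
          + B ℚ./ 1             ∎))) (ℤ.≤-reflexive (shift (+ C) (+ B)))
  in greatest em (λ q → fromℤ q ≤ x) (ℤ.- + C) (C ℕ.+ B) lower upper
  where
  open ℚ.≤-Reasoning
  open +-*-Solver
  flip : ∀ s o → 0ℚ ℚ.- (o ℚ.- s) ≡ s ℚ.- o
  flip = solve 2 (λ s o → con 0ℚ :- (o :- s) := s :- o) refl
  shift : ∀ c b → b ≡ ℤ.- c ℤ.+ (c ℤ.+ b)
  shift c b = trans (sym (ℤ.+-identityˡ b)) (trans (cong (ℤ._+ b) (sym (ℤ.+-inverseˡ c))) (ℤ.+-assoc (ℤ.- c) c b))

-- Euclidean balls and coordinates

term≤∑ : ∀ {d} (v : Vector ℝ d) n → (∀ i → 0ℚ ℚ.≤ seq (v i) n) → ∀ i → seq (v i) n ℚ.≤ seq (∑ v) n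
term≤∑ {suc d} v n v≥0 i = go i
  where
  0≤∑ : ∀ {d} (v : Vector ℝ d) → (∀ i → 0ℚ ℚ.≤ seq (v i) n) → 0ℚ ℚ.≤ seq (∑ v) n
  0≤∑ {zero}  v v≥0 = ℚ.≤-refl
  0≤∑ {suc d} v v≥0 = ℚ.+-mono-≤ (v≥0 zero) (0≤∑ (v ∘ suc) (v≥0 ∘ suc))
  go : ∀ i → seq (v i) n ℚ.≤ seq (∑ v) n
  go zero    = subst (ℚ._≤ seq (∑ v) n) (ℚ.+-identityʳ _) (ℚ.+-monoʳ-≤ (seq (v zero) n) (0≤∑ (v ∘ suc) (v≥0 ∘ suc)))
  go (suc i) = subst (ℚ._≤ seq (∑ v) n) (ℚ.+-identityˡ _) (ℚ.+-mono-≤ (v≥0 zero) (term≤∑ (v ∘ suc) n (v≥0 ∘ suc) i))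

-- A single squared difference is at most the sum of squares. The threshold `N` comes from the bound
-- on that sum, so it serves all coordinates at once.
Ball⇒coordinate< : ∀ {d} {c y : Vector ℝ d} {ρ} → 0ℚ ℚ.< ρ → y ∈ Ball c (fromℚ ρ) →
  ∃ λ N → ∀ n → N ℕ.≤ n → ∀ i → seq (y i) n ℚ.< seq (c i) n ℚ.+ ρ
Ball⇒coordinate< {c = c} {y} {ρ} ρ>0 (_ , δ , δ>0 , N , ∑+δ≤ρ²) = N , λ n p i →
  let t = seq (y i) n ℚ.- seq (c i) n
      t<ρ : t ℚ.< ρ
      t<ρ = p²-cancel-< (ℚ.<⇒≤ ρ>0) (begin-strict
        t ℚ.* t                       ≤⟨ term≤∑ (λ i → (y i - c i) * (y i - c i)) n (λ i → 0≤p² (seq (y i) n ℚ.- seq (c i) n)) i ⟩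
        seq (∑ (λ i → (y i - c i) * (y i - c i))) n         <⟨ p<p+ε _ δ>0 ⟩
        seq (∑ (λ i → (y i - c i) * (y i - c i))) n ℚ.+ δ   ≤⟨ ∑+δ≤ρ² n p ⟩
        ρ ℚ.* ρ                       ∎)
  in begin-strict
    seq (y i) n           ≡⟨ p≡q+[p-q] (seq (y i) n) (seq (c i) n) ⟩
    seq (c i) n ℚ.+ t     <⟨ ℚ.+-monoʳ-< (seq (c i) n) t<ρ ⟩
    seq (c i) n ℚ.+ ρ     ∎
  where open ℚ.≤-Reasoning

uniformGap : ∀ {d} {x y : Vector ℝ d} → (∀ i → x i < y i) →
  ∃ λ ε → 0ℚ ℚ.< ε × ∃ λ N → ∀ n → N ℕ.≤ n → ∀ i → seq (x i) n ℚ.+ ε ℚ.≤ seq (y i) n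
uniformGap {zero}          x<y = 1ℚ , ℚ.positive⁻¹ 1ℚ , 0 , λ _ _ ()
uniformGap {suc d} {x} {y} x<y =
  let ε₀ , ε₀>0 , M , h₀ = x<y zero
      ε₁ , ε₁>0 , N , h₁ = uniformGap {x = x ∘ suc} {y ∘ suc} (x<y ∘ suc)
  in ε₀ ℚ.⊓ ε₁ , ⊓-pos ε₀>0 ε₁>0 , M ℕ.⊔ N , λ
    { n p zero    → ℚ.≤-trans (ℚ.+-monoʳ-≤ (seq (x zero) n) (ℚ.p⊓q≤p ε₀ ε₁)) (h₀ n (ℕ.m⊔n≤o⇒m≤o M N p))
    ; n p (suc i) → ℚ.≤-trans (ℚ.+-monoʳ-≤ (seq (x (suc i)) n) (ℚ.p⊓q≤q ε₀ ε₁)) (h₁ n (ℕ.m⊔n≤o⇒n≤o M N p) i) }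
  where
  ⊓-pos : ∀ {p q} → 0ℚ ℚ.< p → 0ℚ ℚ.< q → 0ℚ ℚ.< p ℚ.⊓ q
  ⊓-pos {p} {q} p>0 q>0 with ℚ.⊓-sel p q
  ... | inj₁ eq = subst (0ℚ ℚ.<_) (sym eq) p>0
  ... | inj₂ eq = subst (0ℚ ℚ.<_) (sym eq) q>0

-- The recursion mirrors `foldr`, so that it matches the terms of `∑` step by step.
∑-const : ℕ → ℚ → ℚ
∑-const zero    t = 0ℚ
∑-const (suc d) t = t ℚ.+ ∑-const d t

∑-const-mono-≤ : ∀ d {s t} → s ℚ.≤ t → ∑-const d s ℚ.≤ ∑-const d t
∑-const-mono-≤ zero    s≤t = ℚ.≤-refl
∑-const-mono-≤ (suc d) s≤t = ℚ.+-mono-≤ s≤t (∑-const-mono-≤ d s≤t)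

-- The extra term δ² is the gap that makes the offset (δ,…,δ) strictly shorter than ε.
smallDiagonal : ∀ d ε → 0ℚ ℚ.< ε →
  ∃ λ δ → 0ℚ ℚ.< δ × ∑-const d (δ ℚ.* δ) ℚ.+ δ ℚ.* δ ℚ.≤ ε ℚ.* ε
smallDiagonal zero    ε ε>0 = ε , ε>0 , ℚ.≤-reflexive (ℚ.+-identityˡ (ε ℚ.* ε))
smallDiagonal (suc d) ε ε>0 =
  let δ , δ>0 , ≤ε² = smallDiagonal d ε ε>0
      -- Halving pays for one more coordinate: the new square and the new gap together fit into the
      -- old gap `δ²`.
      h = ½ ℚ.* δ
      h² = h ℚ.* h
      h²+h²≤δ² : h² ℚ.+ h² ℚ.≤ δ ℚ.* δ
      h²+h²≤δ² = begin
        h² ℚ.+ h²                              ≡⟨ ℚ.+-identityʳ (h² ℚ.+ h²) ⟨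
        h² ℚ.+ h² ℚ.+ 0ℚ                       ≤⟨ ℚ.+-monoʳ-≤ (h² ℚ.+ h²) (ℚ.+-mono-≤ (0≤p² h) (0≤p² h)) ⟩
        h² ℚ.+ h² ℚ.+ (h² ℚ.+ h²)              ≡⟨ square h ⟩
        (h ℚ.+ h) ℚ.* (h ℚ.+ h)                ≡⟨ cong₂ ℚ._*_ (half+half δ) (half+half δ) ⟩
        δ ℚ.* δ                                ∎
      h²≤δ² = p²-mono-≤ (ℚ.<⇒≤ (half-pos δ>0)) (ℚ.<⇒≤ (half< δ>0))
  in h , half-pos δ>0 , (begin
    h² ℚ.+ ∑-const d h² ℚ.+ h²           ≡⟨ regroup h² (∑-const d h²) ⟩
    ∑-const d h² ℚ.+ (h² ℚ.+ h²)         ≤⟨ ℚ.+-mono-≤ (∑-const-mono-≤ d h²≤δ²) h²+h²≤δ² ⟩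
    ∑-const d (δ ℚ.* δ) ℚ.+ δ ℚ.* δ      ≤⟨ ≤ε² ⟩
    ε ℚ.* ε                              ∎)
  where
  open ℚ.≤-Reasoning
  open +-*-Solver
  square : ∀ h → h ℚ.* h ℚ.+ h ℚ.* h ℚ.+ (h ℚ.* h ℚ.+ h ℚ.* h) ≡ (h ℚ.+ h) ℚ.* (h ℚ.+ h)
  square = solve 1 (λ h → h :* h :+ h :* h :+ (h :* h :+ h :* h) := (h :+ h) :* (h :+ h)) refl
  regroup : ∀ a b → a ℚ.+ b ℚ.+ a ≡ b ℚ.+ (a ℚ.+ a)
  regroup = solve 2 (λ a b → a :+ b :+ a := b :+ (a :+ a)) refl

seq-∑-const : ∀ {d} (v : Vector ℝ d) n t → (∀ i → seq (v i) n ≡ t) → seq (∑ v) n ≡ ∑-const d t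
seq-∑-const {zero}  v n t v≡t = refl
seq-∑-const {suc d} v n t v≡t = cong₂ ℚ._+_ (v≡t zero) (seq-∑-const (v ∘ suc) n t (v≡t ∘ suc))

∑-const-0 : ∀ d → ∑-const d 0ℚ ≡ 0ℚ
∑-const-0 zero    = refl
∑-const-0 (suc d) = trans (ℚ.+-identityˡ (∑-const d 0ℚ)) (∑-const-0 d)

centre∈Ball : ∀ {d} (x : Vector ℝ d) {ρ} → 0ℚ ℚ.< ρ → x ∈ Ball x (fromℚ ρ)
centre∈Ball {d} x {ρ} ρ>0 =
    (ρ , ρ>0 , 0 , λ _ _ → ℚ.≤-reflexive (ℚ.+-identityˡ ρ))
  , ρ ℚ.* ρ , p²-pos ρ>0 , 0 , λ n _ → ℚ.≤-reflexive (trans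
      (cong (ℚ._+ ρ ℚ.* ρ) (trans
        (seq-∑-const (λ i → (x i - x i) * (x i - x i)) n 0ℚ
          (λ i → cong₂ ℚ._*_ (ℚ.+-inverseʳ (seq (x i) n)) (ℚ.+-inverseʳ (seq (x i) n))))
        (∑-const-0 d)))
      (ℚ.+-identityˡ (ρ ℚ.* ρ)))

Ball∋diagonal : ∀ {d} (x : Vector ℝ d) r → 0ℝ < r →
  ∃ λ δ → 0ℚ ℚ.< δ × (λ i → x i + fromℚ δ) ∈ Ball x r
Ball∋diagonal {d} x r r>0@(ε , ε>0 , N , ε≤r) =
  let δ , δ>0 , ≤ε² = smallDiagonal d ε ε>0
  in δ , δ>0 , r>0 , δ ℚ.* δ , p²-pos δ>0 , N , λ n p → begin
    seq (∑ (λ i → (x i + fromℚ δ - x i) * (x i + fromℚ δ - x i))) n ℚ.+ δ ℚ.* δ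
      ≡⟨ cong (ℚ._+ δ ℚ.* δ) (seq-∑-const _ n (δ ℚ.* δ)
           (λ i → cong₂ ℚ._*_ (cancel (seq (x i) n) δ) (cancel (seq (x i) n) δ))) ⟩
    ∑-const d (δ ℚ.* δ) ℚ.+ δ ℚ.* δ
      ≤⟨ ≤ε² ⟩
    ε ℚ.* ε
      ≤⟨ p²-mono-≤ (ℚ.<⇒≤ ε>0) (subst (ℚ._≤ seq r n) (ℚ.+-identityˡ ε) (ε≤r n p)) ⟩
    seq r n ℚ.* seq r n ∎
  where
  open ℚ.≤-Reasoning
  open +-*-Solver
  cancel : ∀ a b → a ℚ.+ b ℚ.- a ≡ b
  cancel = solve 2 (λ a b → a :+ b :- a := b) refl

-- Characterisation of Σᶜ

module _ {d} {L : Pred (Vector ℤ d) 0ℓ} where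

  -- If `x` were below `q` in all coordinates, a whole ball around `x` would lie below `q`, yet that
  -- ball meets `Σᴿ L`.
  Σᶜ⇒≮ : ∀ {x} → x ∈ Σᶜ L → ∀ q → q ∈ L → ¬ (∀ i → x i < fromℤ (q i))
  Σᶜ⇒≮ {x} x∈Σ q q∈L x<q =
    let ρ , ρ>0 , M , x+ρ≤q = uniformGap {x = x} {ι q} x<q
        y , y∈Ball , y∈Σᴿ = x∈Σ (fromℚ ρ) (ρ , ρ>0 , 0 , λ _ _ → ℚ.≤-reflexive (ℚ.+-identityˡ ρ))
        N , y<x+ρ = Ball⇒coordinate< {c = x} {y} {ρ} ρ>0 y∈Ball
    in y∈Σᴿ q q∈L λ i ε ε>0 → M ℕ.⊔ N , λ n p → ℚ.<-trans
      (ℚ.<-≤-trans (y<x+ρ n (ℕ.m⊔n≤o⇒n≤o M N p) i) (x+ρ≤q n (ℕ.m⊔n≤o⇒m≤o M N p) i))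
      (p<p+ε (q i ℚ./ 1) ε>0)

  Σᶜ⇒reaches : ExcludedMiddle 0ℓ → ∀ {x} → x ∈ Σᶜ L → ∀ q → q ∈ L → ∃ λ i → fromℤ (q i) ≤ x i
  Σᶜ⇒reaches em {x} x∈Σ q q∈L = decidable-stable em λ ∄i →
    Σᶜ⇒≮ {x} x∈Σ q q∈L λ i → decidable-stable em λ x≮q →
      ∄i (i , ≮⇒≥ {x i} {fromℤ (q i)} x≮q)

  -- A small shift along the diagonal turns each `q i ≤ x i` into a strict inequality, so points of
  -- `Σᴿ L` lie arbitrarily close to `x`.
  reaches⇒Σᶜ : ∀ {x} → (∀ q → q ∈ L → ∃ λ i → fromℤ (q i) ≤ x i) → x ∈ Σᶜ L
  reaches⇒Σᶜ {x} reaches r r>0 =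
    let δ , δ>0 , y∈Ball = Ball∋diagonal x r r>0
        y = λ i → x i + fromℚ δ
        h = ½ ℚ.* δ
        y∈Σᴿ : y ∈ Σᴿ L
        y∈Σᴿ q q∈L y≤q =
          let i , q≤x = reaches q q∈L
              M , q<x+h = q≤x h (half-pos δ>0)
              N , y<q+h = y≤q i h (half-pos δ>0)
              n = M ℕ.⊔ N
          in contradiction (begin-strict
            seq (x i) n ℚ.+ δ            <⟨ y<q+h n (ℕ.m≤n⊔m M N) ⟩
            q i ℚ./ 1 ℚ.+ h              <⟨ ℚ.+-monoˡ-< h (q<x+h n (ℕ.m≤m⊔n M N)) ⟩
            seq (x i) n ℚ.+ h ℚ.+ h      ≡⟨ ℚ.+-assoc (seq (x i) n) h h ⟩
            seq (x i) n ℚ.+ (h ℚ.+ h)    ≡⟨ cong (seq (x i) n ℚ.+_) (half+half δ) ⟩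
            seq (x i) n ℚ.+ δ            ∎) (ℚ.<-irrefl refl)
    in y , y∈Ball , y∈Σᴿ
    where open ℚ.≤-Reasoning

-- Minimal integral points as local minima of the degree

Ball½⇒≤ : ∀ {d} (ν : Vector ℤ d) y → y ∈ Ball (ι ν) (fromℚ ½) →
  ∀ i z → fromℤ z ≤ y i → z ℤ.≤ ν i
Ball½⇒≤ ν y y∈Ball i z z≤yi = compare (z≤yi ½ ½>0) (Ball⇒coordinate< {c = ι ν} {y} {½} ½>0 y∈Ball)
  where
  open ℚ.≤-Reasoning
  ½>0 : 0ℚ ℚ.< ½
  ½>0 = ℚ.positive⁻¹ ½
  -- The radius ½ and the slack ½ allowed in `fromℤ z ≤ y i` add up to exactly 1, so integrality
  -- gives `z ≤ ν i`.
  z<ν+1 : ∀ {s} → z ℚ./ 1 ℚ.< s ℚ.+ ½ → s ℚ.< ν i ℚ./ 1 ℚ.+ ½ → z ℤ.< ν i ℤ.+ 1ℤ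
  z<ν+1 {s} z<s+½ s<ν+½ = /1-cancel-< (begin-strict
    z ℚ./ 1                     <⟨ z<s+½ ⟩
    s ℚ.+ ½                     <⟨ ℚ.+-monoˡ-< ½ s<ν+½ ⟩
    ν i ℚ./ 1 ℚ.+ ½ ℚ.+ ½       ≡⟨ ℚ.+-assoc (ν i ℚ./ 1) ½ ½ ⟩
    ν i ℚ./ 1 ℚ.+ (½ ℚ.+ ½)     ≡⟨ /1-homo-+ (ν i) 1ℤ ⟨
    (ν i ℤ.+ 1ℤ) ℚ./ 1          ∎)
  compare :
    (∃ λ N → ∀ n → N ℕ.≤ n → z ℚ./ 1 ℚ.< seq (y i) n ℚ.+ ½) →
    (∃ λ N → ∀ n → N ℕ.≤ n → ∀ i → seq (y i) n ℚ.< ν i ℚ./ 1 ℚ.+ ½) → z ℤ.≤ ν i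
  compare (M , z<y+½) (N , y<ν+½) = subst (z ℤ.≤_)
    (trans (cong ℤ.pred (ℤ.+-comm (ν i) 1ℤ)) (ℤ.pred-suc (ν i)))
    (ℤ.i<j⇒i≤pred[j] (z<ν+1 (z<y+½ (M ℕ.⊔ N) (ℕ.m≤m⊔n M N)) (y<ν+½ (M ℕ.⊔ N) (ℕ.m≤n⊔m M N) i)))
module _ {d} {L : Pred (Vector ℤ d) 0ℓ} (em : ExcludedMiddle 0ℓ) where

  Σᶻ⇒Σᶜ : ∀ {z} → z ∈ Σᶻ L → ι z ∈ Σᶜ L
  Σᶻ⇒Σᶜ {z} z∈Σ = reaches⇒Σᶜ {x = ι z} λ q q∈L →
    let i , q≤z = z∈Σ q q∈L in i , fromℤ-mono-≤ {q i} {z i} q≤z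

  Σᶜ-upwardClosed : ∀ {x y} → x ∈ Σᶜ L → x ≤ᵛ y → y ∈ Σᶜ L
  Σᶜ-upwardClosed {x} {y} x∈Σ x≤y = reaches⇒Σᶜ {x = y} λ q q∈L →
    let i , q≤x = Σᶜ⇒reaches em {x} x∈Σ q q∈L
    in i , ≤-trans {fromℤ (q i)} {x i} {y i} q≤x (x≤y i)

  -- More than minimal degree holds: `ι ν` is the least element, coordinatewise, of the part of
  -- `Σᶜ L` in the ball of radius ½.
  minimal⇒Extᶜ : ∀ ν → ν ∈ Σᶻ L → (∀ i → ¬ Σᶻ L (updateAt ν i ℤ.pred)) → ι ν ∈ Extᶜ L
  minimal⇒Extᶜ ν ν∈Σ min =
      Σᶻ⇒Σᶜ {ν} ν∈Σ , ι ν , fromℚ ½ , centre∈Ball (ι ν) {½} (ℚ.positive⁻¹ ½)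
    , λ y (y∈Ball , y∈Σ) → deg-mono-≤ {x = ι ν} {y} λ i →
        let q , q∈L , νi≤qi , ν<q = minimal⇒blocked em ν min i
            j , qj≤yj = Σᶜ⇒reaches em {y} y∈Σ q q∈L
        in ν≤ y i j q νi≤qi (ν<q j) qj≤yj (Ball½⇒≤ ν y y∈Ball j (q j) qj≤yj) (i Fin.≟ j)
    where
    ν≤ : ∀ y i j (q : Vector ℤ d) → ν i ℤ.≤ q i → (i ≢ j → ν j ℤ.< q j) →
      fromℤ (q j) ≤ y j → q j ℤ.≤ ν j → Dec (i ≡ j) → fromℤ (ν i) ≤ y i
    ν≤ y i j q νi≤qi _ qj≤yj _ (yes refl) =
      ≤-trans {fromℤ (ν i)} {fromℤ (q i)} {y i} (fromℤ-mono-≤ {ν i} {q i} νi≤qi) qj≤yj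
    ν≤ y i j q _ νj<qj _ qj≤νj (no i≢j) = contradiction qj≤νj (ℤ.<⇒≱ (νj<qj i≢j))

mainTheorem6 : ExcludedMiddle 0ℓ →
    (n : ℕ) → n ℕ.≥ 1 →
    (L : Pred (Vector ℤ (suc n)) 0ℓ) → IsSublattice L (A n) → HasRank L n →
    Σᶜ L ≐ ⋃ (∃ (Extᶜ L)) (λ ν x → x ≥ᵛ proj₁ ν)
mainTheorem6 em n _ L lattice rank =
    (λ {x} → covered x)
  , λ {x} ((ν , ν∈Σ , _) , ν≤x) → Σᶜ-upwardClosed em {ν} {x} ν∈Σ ν≤x
  where
  open IsSublattice lattice
  positive = positiveOff lattice (λ {q} q∈L → A⇒sum≡0 {q = q} (sub {q} q∈L)) rank
  covered : ∀ x → x ∈ Σᶜ L → x ∈ ⋃ (∃ (Extᶜ L)) (λ ν x → x ≥ᵛ proj₁ ν)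
  covered x x∈Σ =
    -- Rounding down keeps every reached lattice point reached: an integer at most `x i` is at most
    -- its floor.
    let z = λ i → proj₁ (floor em (x i))
        z∈Σ : z ∈ Σᶻ L
        z∈Σ q q∈L = let i , q≤x = Σᶜ⇒reaches em {x} x∈Σ q q∈L
                    in i , proj₂ (proj₂ (floor em (x i))) (q i) q≤x
        ν , ν∈Σ , ν≤z , min = Σᶻ-minimal lattice positive em z z∈Σ
    in (ι ν , minimal⇒Extᶜ em ν ν∈Σ min)
     , λ i → ≤-trans {fromℤ (ν i)} {fromℤ (z i)} {x i}
         (fromℤ-mono-≤ {ν i} {z i} (ν≤z i)) (proj₁ (proj₂ (floor em (x i))))
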